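{- Let $\vec r=\langle r_0,\dots,r_{n-1}\rangle$ be a finite tuple of parameters and let $\varphi\in\mathrm{Fm}(p,\vec r)$. Then $\varphi$ is $\mathrm{S5}$-additive (with respect to $p$) if and only if $\varphi$ is $\mathrm{S5}$-equivalent to a formula from $$A_{\mathrm{S5}}=\Bigl\{(\lambda\wedge p)\vee\bigvee_{i<k}\bigl(\mu_i\wedge\Diamond(\nu_i\wedge p)\bigr)\vee\varkappa \;\Bigm|\; k\in\omega;\ \varkappa,\lambda,\mu_i,\nu_i\in\mathrm{Fm}(\vec r)\Bigr\}.$$
   Context: Modal formulas are built from propositional variables using Boolean connectives, $\bot$, $\top$, $\Diamond$ and $\Box$. The variable $p$ and the variable $q$ are distinct non-parameter variables; parameters are variables distinct from $p$ and $q$. $\mathrm{Fm}(p,\vec r)$ is the set of modal formulas containing no variables other than $p,r_0,\dots,r_{n-1}$; $\mathrm{Fm}(\vec r)$ is the set of modal formulas containing no variables other than $r_0,\dots,r_{n-1}$. For a normal modal logic $\Lambda$, formulas $\varphi,\psi$ are $\Lambda$-equivalent if $\Lambda\vdash\varphi\leftrightarrow\psi$. A formula $\varphi(p,\vec r)$ is $\Lambda$-additive if $\Lambda\vdash\varphi(p\vee q,\vec r)\leftrightarrow\varphi(p,\vec r)\vee\varphi(q,\vec r)$. $\mathrm{S5}$ is the usual normal modal logic of frames whose relation is an equivalence relation. An empty disjunction is $\bot$. -}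

module Defs where

open import Data.Bool as Bool using (Bool; true; false; not)
open import Data.Fin using (Fin)
open import Data.List using (List; []; _∷_; _++_; [_])
open import Data.List.Relation.Binary.Subset.Propositional using (_⊆_)
open import Data.Nat using (ℕ)
open import Data.Product using (∃; _×_)
open import Data.Vec using (Vec; toList; map)
open import Data.Vec.Functional using (Vector; foldr)
open import Level using (0ℓ)
open import Relation.Binary.PropositionalEquality using (_≡_)
open import Relation.Unary using (Pred; _∈_)

-- The two distinguished variables p and q; every other variable is a parameter.
data Var : Set where
  𝕡 𝕢 : Var
  par : ℕ → Var

infix  9 ¬_ □_ ◇_
infixr 7 _∧_
infixr 6 _∨_
infixr 5 _⇒_
infix  4 _↔_

data Fm : Set where
  var         : Var → Fm
  ⊥ ⊤         : Fm
  ¬_          : Fm → Fm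
  _∧_ _∨_ _⇒_ : Fm → Fm → Fm
  □_ ◇_       : Fm → Fm

_↔_ : Fm → Fm → Fm
φ ↔ ψ = (φ ⇒ ψ) ∧ (ψ ⇒ φ)

p q : Fm
p = var 𝕡
q = var 𝕢

⋁ : ∀ {k} → Vector Fm k → Fm
⋁ = foldr _∨_ ⊥

vars : Fm → List Var
vars (var x) = [ x ]
vars ⊥       = []
vars ⊤       = []
vars (¬ φ)   = vars φ
vars (φ ∧ ψ) = vars φ ++ vars ψ
vars (φ ∨ ψ) = vars φ ++ vars ψ
vars (φ ⇒ ψ) = vars φ ++ vars ψ
vars (□ φ)   = vars φ
vars (◇ φ)   = vars φ

-- A tuple of n parameters is given by the indices of its entries.
params : ∀ {n} → Vec ℕ n → List Var
params r = toList (map par r)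

Fm⟨_⟩ : ∀ {n} → Vec ℕ n → Pred Fm 0ℓ
Fm⟨ r ⟩ φ = vars φ ⊆ params r

Fm⟨p,_⟩ : ∀ {n} → Vec ℕ n → Pred Fm 0ℓ
Fm⟨p, r ⟩ φ = vars φ ⊆ 𝕡 ∷ params r

sub : (Var → Fm) → Fm → Fm
sub σ (var x) = σ x
sub σ ⊥       = ⊥
sub σ ⊤       = ⊤
sub σ (¬ φ)   = ¬ sub σ φ
sub σ (φ ∧ ψ) = sub σ φ ∧ sub σ ψ
sub σ (φ ∨ ψ) = sub σ φ ∨ sub σ ψ
sub σ (φ ⇒ ψ) = sub σ φ ⇒ sub σ ψ
sub σ (□ φ)   = □ sub σ φ
sub σ (◇ φ)   = ◇ sub σ φ

p≔_ : Fm → Var → Fm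
(p≔ ψ) 𝕡       = ψ
(p≔ ψ) 𝕢       = q
(p≔ ψ) (par i) = var (par i)

-- φ(ψ, r⃗)
_⟨_⟩ : Fm → Fm → Fm
φ ⟨ ψ ⟩ = sub (p≔ ψ) φ

-- Classical truth-table value; variables and formulas □φ, ◇φ are treated as
-- atoms, whose values are read off v.
eval : (Fm → Bool) → Fm → Bool
eval v (var x) = v (var x)
eval v ⊥       = false
eval v ⊤       = true
eval v (¬ φ)   = not (eval v φ)
eval v (φ ∧ ψ) = eval v φ Bool.∧ eval v ψ
eval v (φ ∨ ψ) = eval v φ Bool.∨ eval v ψ
eval v (φ ⇒ ψ) = not (eval v φ) Bool.∨ eval v ψ
eval v (□ φ)   = v (□ φ)
eval v (◇ φ)   = v (◇ φ)

Tautology : Pred Fm 0ℓ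
Tautology φ = ∀ v → eval v φ ≡ true

-- K⊕ Ax is the least normal modal logic containing Ax; since □ and ◇ are both
-- primitive, their duality is an axiom.
data K⊕ (Ax : Pred Fm 0ℓ) : Pred Fm 0ℓ where
  taut : ∀ {φ} → Tautology φ → K⊕ Ax φ
  K    : K⊕ Ax (□ (p ⇒ q) ⇒ □ p ⇒ □ q)
  dual : K⊕ Ax (◇ p ↔ ¬ □ ¬ p)
  ax   : ∀ {φ} → Ax φ → K⊕ Ax φ
  mp   : ∀ {φ ψ} → K⊕ Ax (φ ⇒ ψ) → K⊕ Ax φ → K⊕ Ax ψ
  nec  : ∀ {φ} → K⊕ Ax φ → K⊕ Ax (□ φ)
  subs : ∀ {φ} (σ : Var → Fm) → K⊕ Ax φ → K⊕ Ax (sub σ φ)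

-- The axioms defining reflexive, transitive and symmetric frames, respectively.
data S5-Axiom : Pred Fm 0ℓ where
  T : S5-Axiom (□ p ⇒ p)
  Four : S5-Axiom (□ p ⇒ □ □ p)
  B : S5-Axiom (p ⇒ □ ◇ p)

S5 : Pred Fm 0ℓ
S5 = K⊕ S5-Axiom

infix 3 _⊢_

_⊢_ : Pred Fm 0ℓ → Fm → Set
Λ ⊢ φ = φ ∈ Λ

Equivalent : Pred Fm 0ℓ → Fm → Fm → Set
Equivalent Λ φ ψ = Λ ⊢ φ ↔ ψ

Additive : Pred Fm 0ℓ → Fm → Set
Additive Λ φ = Λ ⊢ φ ⟨ p ∨ q ⟩ ↔ φ ⟨ p ⟩ ∨ φ ⟨ q ⟩

A-S5 : ∀ {n} → Vec ℕ n → Pred Fm 0ℓ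
A-S5 r χ =
  ∃ λ (k : ℕ) → ∃ λ (ϰ : Fm) → ∃ λ (ƛ : Fm) →
  ∃ λ (μ : Fin k → Fm) → ∃ λ (ν : Fin k → Fm) →
    ϰ ∈ Fm⟨ r ⟩ × ƛ ∈ Fm⟨ r ⟩ × (∀ i → μ i ∈ Fm⟨ r ⟩) × (∀ i → ν i ∈ Fm⟨ r ⟩) ×
    χ ≡ (ƛ ∧ p) ∨ (⋁ λ i → μ i ∧ ◇ (ν i ∧ p)) ∨ ϰ

{-# OPTIONS --safe #-}

-- Doubling every world of an S5-model, with the same parameters on both copies, does not change
-- the truth of formulas. If φ is additive, τ describes the type of a world completely, and
-- δ = τ ∧ p, then φ(δ) in the doubled model is φ(δ, ⊥) ∨ φ(⊥, δ), where the two arguments are the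
-- extensions of p among the first and the second copies. In either disjunct all worlds in p look
-- alike, also to the world of evaluation if that is not one of them, so the truth of φ at the
-- evaluation world agrees with its truth in the parameter model with one extra p-world of type τ
-- added. The latter is expressed by parameter formulas: "off" when evaluated at an original
-- world, "on" when evaluated at the extra one. Thus φ(δ) is
-- φ(⊥) ∨ (δ ∧ on) ∨ (off ∧ ◇ δ), and additivity sums this over the finitely many types.
--
-- Models are replaced by translations of formulas into pairs of formulas, which preserve
-- derivability, so that no completeness theorem for S5 is needed.

module Submission where

open import Defs
open import Data.Bool as Bool using (Bool; true; false; not)
open import Data.Bool.Properties using (T-≡; T-∧)
open import Data.Empty using (⊥-elim)
open import Data.Fin using (Fin; zero; suc; funToFin; finToFun)
open import Data.Fin.Patterns
open import Data.Fin.Properties using (finToFun-funToFin; 2↔Bool)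
open import Data.List using (List; _++_) renaming (_∷_ to _∷ᴸ_)
open import Data.List.Membership.Propositional using () renaming (_∈_ to _∈ˡ_)
open import Data.List.Membership.Propositional.Properties using (∈-++⁺ˡ; ∈-++⁺ʳ; ∈-++⁻)
open import Data.List.Relation.Binary.Subset.Propositional using (_⊆_)
open import Data.List.Relation.Unary.Any using (here; there)
open import Data.Nat using (ℕ; zero; suc; _+_; _^_; _≟_)
open import Data.Product using (∃; _×_; _,_; proj₁; proj₂)
open import Data.Sum using ([_,_])
open import Data.Vec as Vec using (Vec; []; _∷_; lookup; tabulate)
open import Data.Vec.Properties using (lookup-map; tabulate-cong; tabulate∘lookup)
open import Function using (_∘_)
open import Function.Bundles using (_⇔_; mk⇔; Equivalence; Inverse)
open import Relation.Binary.PropositionalEquality using (_≡_; refl; sym; trans; cong; cong₂; subst)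
open import Relation.Nullary using (yes; no)
open import Relation.Unary using (_∈_)

infixl 1 _·_

⊢_ : Fm → Set
⊢ φ = S5 ⊢ φ

infix 3 ⊢_

_·_ : ∀ {φ ψ} → ⊢ φ ⇒ ψ → ⊢ φ → ⊢ ψ
_·_ = mp

-- Propositional reasoning by truth tables

data Schema (n : ℕ) : Set where
  at          : Fin n → Schema n
  ⊥           : Schema n
  ¬_          : Schema n → Schema n
  _∧_ _∨_ _⇒_ : Schema n → Schema n → Schema n

_↔ˢ_ : ∀ {n} → Schema n → Schema n → Schema n
s ↔ˢ t = (s ⇒ t) ∧ (t ⇒ s)

infix 4 _↔ˢ_

instantiate : ∀ {n} → Vec Fm n → Schema n → Fm
instantiate ρ (at i)  = lookup ρ i
instantiate ρ ⊥       = ⊥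
instantiate ρ (¬ s)   = ¬ instantiate ρ s
instantiate ρ (s ∧ t) = instantiate ρ s ∧ instantiate ρ t
instantiate ρ (s ∨ t) = instantiate ρ s ∨ instantiate ρ t
instantiate ρ (s ⇒ t) = instantiate ρ s ⇒ instantiate ρ t

evalSchema : ∀ {n} → Vec Bool n → Schema n → Bool
evalSchema ρ (at i)  = lookup ρ i
evalSchema ρ ⊥       = false
evalSchema ρ (¬ s)   = not (evalSchema ρ s)
evalSchema ρ (s ∧ t) = evalSchema ρ s Bool.∧ evalSchema ρ t
evalSchema ρ (s ∨ t) = evalSchema ρ s Bool.∨ evalSchema ρ t
evalSchema ρ (s ⇒ t) = not (evalSchema ρ s) Bool.∨ evalSchema ρ t

everywhere : ∀ n → (Vec Bool n → Bool) → Bool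
everywhere zero    f = f []
everywhere (suc n) f = everywhere n (f ∘ (true ∷_)) Bool.∧ everywhere n (f ∘ (false ∷_))

everywhere-sound : ∀ n f → Bool.T (everywhere n f) → ∀ bs → Bool.T (f bs)
everywhere-sound zero    f t []           = t
everywhere-sound (suc n) f t (true  ∷ bs) =
  everywhere-sound n _ (proj₁ (Equivalence.to T-∧ t)) bs
everywhere-sound (suc n) f t (false ∷ bs) =
  everywhere-sound n _ (proj₂ (Equivalence.to (T-∧ {everywhere n (f ∘ (true ∷_))}) t)) bs

eval-instantiate : ∀ {n} v (ρ : Vec Fm n) s →
  eval v (instantiate ρ s) ≡ evalSchema (Vec.map (eval v) ρ) s
eval-instantiate v ρ (at i)  = sym (lookup-map i (eval v) ρ)
eval-instantiate v ρ ⊥       = refl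
eval-instantiate v ρ (¬ s)   = cong not (eval-instantiate v ρ s)
eval-instantiate v ρ (s ∧ t) = cong₂ Bool._∧_ (eval-instantiate v ρ s) (eval-instantiate v ρ t)
eval-instantiate v ρ (s ∨ t) = cong₂ Bool._∨_ (eval-instantiate v ρ s) (eval-instantiate v ρ t)
eval-instantiate v ρ (s ⇒ t) =
  cong₂ (λ x y → not x Bool.∨ y) (eval-instantiate v ρ s) (eval-instantiate v ρ t)

-- For a closed schema the hidden argument computes to the unit type and is filled in by
-- unification, so the type checker verifies the truth table.
tautology : ∀ {n} (s : Schema n) {_ : Bool.T (everywhere n λ bs → evalSchema bs s)} (ρ : Vec Fm n) →
  ⊢ instantiate ρ s
tautology {n} s {t} ρ = taut λ v → trans (eval-instantiate v ρ s)
  (Equivalence.to T-≡ (everywhere-sound n _ t (Vec.map (eval v) ρ)))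

a : ∀ {n} → Schema (1 + n)
a = at 0F

b : ∀ {n} → Schema (2 + n)
b = at 1F

c : ∀ {n} → Schema (3 + n)
c = at 2F

d : ∀ {n} → Schema (4 + n)
d = at 3F

e : ∀ {n} → Schema (5 + n)
e = at 4F

f : ∀ {n} → Schema (6 + n)
f = at 5F

g : ∀ {n} → Schema (7 + n)
g = at 6F

h : ∀ {n} → Schema (8 + n)
h = at 7F

true⊢ : ⊢ ⊤
true⊢ = taut λ _ → refl

⇒-trans : ∀ {α β γ} → ⊢ α ⇒ β → ⊢ β ⇒ γ → ⊢ α ⇒ γ
⇒-trans {α} {β} {γ} x y = tautology ((a ⇒ b) ⇒ (b ⇒ c) ⇒ a ⇒ c) (α ∷ β ∷ γ ∷ []) · x · y

⇒-const : ∀ {α β} → ⊢ β → ⊢ α ⇒ β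
⇒-const {α} {β} x = tautology (b ⇒ a ⇒ b) (α ∷ β ∷ []) · x

↔-refl : ∀ {α} → ⊢ α ↔ α
↔-refl {α} = tautology (a ↔ˢ a) (α ∷ [])

-- Modal reasoning

pq≔ : Fm → Fm → Var → Fm
pq≔ α β 𝕡       = α
pq≔ α β 𝕢       = β
pq≔ α β (par i) = var (par i)

□-K : ∀ {α β} → ⊢ □ (α ⇒ β) ⇒ □ α ⇒ □ β
□-K {α} {β} = subs (pq≔ α β) K

◇-dual : ∀ {α} → ⊢ ◇ α ↔ ¬ □ ¬ α
◇-dual {α} = subs (pq≔ α q) dual

□-T : ∀ {α} → ⊢ □ α ⇒ α
□-T {α} = subs (pq≔ α q) (ax T)

□-4 : ∀ {α} → ⊢ □ α ⇒ □ □ α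
□-4 {α} = subs (pq≔ α q) (ax Four)

□-mono : ∀ {α β} → ⊢ α ⇒ β → ⊢ □ α ⇒ □ β
□-mono x = □-K · nec x

□-mono₂ : ∀ {α β γ} → ⊢ α ⇒ β ⇒ γ → ⊢ □ α ⇒ □ β ⇒ □ γ
□-mono₂ x = ⇒-trans (□-mono x) □-K

□-B : ∀ {α} → ⊢ α ⇒ □ ¬ □ ¬ α
□-B {α} = ⇒-trans (subs (pq≔ α q) (ax B))
  (□-mono (tautology (a ∧ b ⇒ a) (_ ∷ _ ∷ []) · ◇-dual))

-- B at `¬ □ α` gives `□ ¬ □ ¬ ¬ □ α`; under the outer box, 4 contraposed turns `¬ □ ¬ ¬ □ α` into
-- `¬ □ α`.
□-5 : ∀ {α} → ⊢ ¬ □ α ⇒ □ ¬ □ α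
□-5 {α} = ⇒-trans □-B (□-mono
  (tautology ((a ⇒ b) ⇒ ¬ b ⇒ ¬ a) (_ ∷ _ ∷ [])
    · ⇒-trans □-4 (□-mono (tautology (a ⇒ ¬ ¬ a) (□ α ∷ [])))))

□-equiv : ∀ {α β} → ⊢ α ↔ β → ⊢ □ α ↔ □ β
□-equiv x = tautology (a ⇒ b ⇒ a ∧ b) (_ ∷ _ ∷ [])
  · □-mono (tautology (a ∧ b ⇒ a) (_ ∷ _ ∷ []) · x)
  · □-mono (tautology (a ∧ b ⇒ b) (_ ∷ _ ∷ []) · x)

-- Rigid and global formulas

-- Semantically, a truth value that is constant on every cluster; truth at the extra world will be
-- of this kind.
Rigid : Fm → Set
Rigid α = ⊢ □ α ∨ □ ¬ α

rigid-⊤ : Rigid ⊤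
rigid-⊤ = tautology (a ⇒ a ∨ b) (_ ∷ _ ∷ []) · nec true⊢

rigid-⊥ : Rigid ⊥
rigid-⊥ = tautology (b ⇒ a ∨ b) (_ ∷ _ ∷ []) · nec (tautology (¬ ⊥) [])

rigid-cong : ∀ {α β} → ⊢ α ↔ β → Rigid α → Rigid β
rigid-cong {α} {β} x r =
  tautology ((a ⇒ b) ⇒ (c ⇒ d) ⇒ a ∨ c ⇒ b ∨ d) (_ ∷ _ ∷ _ ∷ _ ∷ [])
    · □-mono (tautology ((a ↔ˢ b) ⇒ a ⇒ b) (α ∷ β ∷ []) · x)
    · □-mono (tautology ((a ↔ˢ b) ⇒ ¬ a ⇒ ¬ b) (α ∷ β ∷ []) · x)
    · r

rigid-¬ : ∀ {α} → Rigid α → Rigid (¬ α)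
rigid-¬ {α} r = tautology ((a ⇒ c) ⇒ a ∨ b ⇒ b ∨ c) (_ ∷ _ ∷ _ ∷ [])
  · □-mono (tautology (a ⇒ ¬ ¬ a) (α ∷ [])) · r

rigid-∧ : ∀ {α β} → Rigid α → Rigid β → Rigid (α ∧ β)
rigid-∧ {α} {β} r s =
  tautology ((a ⇒ c ⇒ e) ⇒ (b ⇒ f) ⇒ (d ⇒ f) ⇒ a ∨ b ⇒ c ∨ d ⇒ e ∨ f)
    (_ ∷ _ ∷ _ ∷ _ ∷ _ ∷ _ ∷ [])
    · □-mono₂ (tautology (a ⇒ b ⇒ a ∧ b) (α ∷ β ∷ []))
    · □-mono (tautology (¬ a ⇒ ¬ (a ∧ b)) (α ∷ β ∷ []))
    · □-mono (tautology (¬ b ⇒ ¬ (a ∧ b)) (α ∷ β ∷ []))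
    · r · s

rigid-∨ : ∀ {α β} → Rigid α → Rigid β → Rigid (α ∨ β)
rigid-∨ {α} {β} r s = rigid-cong (tautology (¬ (¬ a ∧ ¬ b) ↔ˢ a ∨ b) (α ∷ β ∷ []))
  (rigid-¬ (rigid-∧ (rigid-¬ r) (rigid-¬ s)))

rigid-⇒ : ∀ {α β} → Rigid α → Rigid β → Rigid (α ⇒ β)
rigid-⇒ {α} {β} r s = rigid-cong (tautology (¬ (a ∧ ¬ b) ↔ˢ a ⇒ b) (α ∷ β ∷ []))
  (rigid-¬ (rigid-∧ r (rigid-¬ s)))

rigid-□ : ∀ {α} → Rigid (□ α)
rigid-□ {α} = tautology ((a ⇒ b) ⇒ (¬ a ⇒ c) ⇒ b ∨ c) (□ α ∷ _ ∷ _ ∷ []) · □-4 · □-5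

Global : Fm → Set
Global η = ⊢ η ⇒ □ η

rigid⇒global : ∀ {α} → Rigid α → Global α
rigid⇒global r = tautology ((c ⇒ ¬ a) ⇒ b ∨ c ⇒ a ⇒ b) (_ ∷ _ ∷ _ ∷ []) · □-T · r

□-cong : ∀ {η α β} → Global η → ⊢ η ⇒ (α ↔ β) → ⊢ η ⇒ (□ α ↔ □ β)
□-cong {η} {α} {β} γ x =
  tautology ((a ⇒ b) ⇒ (b ⇒ c ⇒ d) ⇒ (b ⇒ d ⇒ c) ⇒ a ⇒ (c ↔ˢ d)) (η ∷ _ ∷ _ ∷ _ ∷ [])
    · γ
    · □-mono₂ (tautology ((a ⇒ (b ↔ˢ c)) ⇒ a ⇒ b ⇒ c) (η ∷ α ∷ β ∷ []) · x)
    · □-mono₂ (tautology ((a ⇒ (b ↔ˢ c)) ⇒ a ⇒ c ⇒ b) (η ∷ α ∷ β ∷ []) · x)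

++⊆ : ∀ {A : Set} {xs ys zs : List A} → xs ⊆ zs → ys ⊆ zs → xs ++ ys ⊆ zs
++⊆ {xs = xs} i j z = [ i , j ] (∈-++⁻ xs z)

-- Formulas over a two-point frame, with formulas as truth values

Valuation : Set
Valuation = Fin 2 → Var → Fm

module Interpretation (box : Fm → Fm → Fm) where

  ⟦_⟧ : Fm → Valuation → Fin 2 → Fm
  ⟦ var x ⟧ V i = V i x
  ⟦ ⊥ ⟧     V i = ⊥
  ⟦ ⊤ ⟧     V i = ⊤
  ⟦ ¬ φ ⟧   V i = ¬ ⟦ φ ⟧ V i
  ⟦ φ ∧ ψ ⟧ V i = ⟦ φ ⟧ V i ∧ ⟦ ψ ⟧ V i
  ⟦ φ ∨ ψ ⟧ V i = ⟦ φ ⟧ V i ∨ ⟦ ψ ⟧ V i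
  ⟦ φ ⇒ ψ ⟧ V i = ⟦ φ ⟧ V i ⇒ ⟦ ψ ⟧ V i
  ⟦ □ φ ⟧   V i = box (⟦ φ ⟧ V 0F) (⟦ φ ⟧ V 1F)
  -- Reading `◇` through its dual makes the translation of `dual` an instance of `α ↔ α`.
  ⟦ ◇ φ ⟧   V i = ¬ box (¬ ⟦ φ ⟧ V 0F) (¬ ⟦ φ ⟧ V 1F)

  ⟦sub⟧ : ∀ σ φ V i → ⟦ sub σ φ ⟧ V i ≡ ⟦ φ ⟧ (λ j x → ⟦ σ x ⟧ V j) i
  ⟦sub⟧ σ (var x) V i = refl
  ⟦sub⟧ σ ⊥       V i = refl
  ⟦sub⟧ σ ⊤       V i = refl
  ⟦sub⟧ σ (¬ φ)   V i = cong ¬_ (⟦sub⟧ σ φ V i)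
  ⟦sub⟧ σ (φ ∧ ψ) V i = cong₂ _∧_ (⟦sub⟧ σ φ V i) (⟦sub⟧ σ ψ V i)
  ⟦sub⟧ σ (φ ∨ ψ) V i = cong₂ _∨_ (⟦sub⟧ σ φ V i) (⟦sub⟧ σ ψ V i)
  ⟦sub⟧ σ (φ ⇒ ψ) V i = cong₂ _⇒_ (⟦sub⟧ σ φ V i) (⟦sub⟧ σ ψ V i)
  ⟦sub⟧ σ (□ φ)   V i = cong₂ box (⟦sub⟧ σ φ V 0F) (⟦sub⟧ σ φ V 1F)
  ⟦sub⟧ σ (◇ φ)   V i =
    cong₂ (λ α β → ¬ box (¬ α) (¬ β)) (⟦sub⟧ σ φ V 0F) (⟦sub⟧ σ φ V 1F)

  -- A classical valuation of the translations pulls back to one of the original formulas; hence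
  -- tautologies translate to tautologies.
  eval-⟦⟧ : ∀ v V i φ → eval v (⟦ φ ⟧ V i) ≡ eval (λ ψ → eval v (⟦ ψ ⟧ V i)) φ
  eval-⟦⟧ v V i (var x) = refl
  eval-⟦⟧ v V i ⊥       = refl
  eval-⟦⟧ v V i ⊤       = refl
  eval-⟦⟧ v V i (¬ φ)   = cong not (eval-⟦⟧ v V i φ)
  eval-⟦⟧ v V i (φ ∧ ψ) = cong₂ Bool._∧_ (eval-⟦⟧ v V i φ) (eval-⟦⟧ v V i ψ)
  eval-⟦⟧ v V i (φ ∨ ψ) = cong₂ Bool._∨_ (eval-⟦⟧ v V i φ) (eval-⟦⟧ v V i ψ)
  eval-⟦⟧ v V i (φ ⇒ ψ) = cong₂ (λ x y → not x Bool.∨ y) (eval-⟦⟧ v V i φ) (eval-⟦⟧ v V i ψ)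
  eval-⟦⟧ v V i (□ φ)   = refl
  eval-⟦⟧ v V i (◇ φ)   = refl

  module _ {X : List Var} (vars-box : ∀ {α β} → vars α ⊆ X → vars β ⊆ X → vars (box α β) ⊆ X)
    where

    vars-⟦⟧ : ∀ φ V i → (∀ {x} → x ∈ˡ vars φ → ∀ j → vars (V j x) ⊆ X) → vars (⟦ φ ⟧ V i) ⊆ X
    vars-⟦⟧ (var x) V i w = w (here refl) i
    vars-⟦⟧ ⊥       V i w = λ ()
    vars-⟦⟧ ⊤       V i w = λ ()
    vars-⟦⟧ (¬ φ)   V i w = vars-⟦⟧ φ V i w
    vars-⟦⟧ (φ ∧ ψ) V i w = ++⊆
      (vars-⟦⟧ φ V i (w ∘ ∈-++⁺ˡ)) (vars-⟦⟧ ψ V i (w ∘ ∈-++⁺ʳ (vars φ)))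
    vars-⟦⟧ (φ ∨ ψ) V i w = ++⊆
      (vars-⟦⟧ φ V i (w ∘ ∈-++⁺ˡ)) (vars-⟦⟧ ψ V i (w ∘ ∈-++⁺ʳ (vars φ)))
    vars-⟦⟧ (φ ⇒ ψ) V i w = ++⊆
      (vars-⟦⟧ φ V i (w ∘ ∈-++⁺ˡ)) (vars-⟦⟧ ψ V i (w ∘ ∈-++⁺ʳ (vars φ)))
    vars-⟦⟧ (□ φ)   V i w = vars-box (vars-⟦⟧ φ V 0F w) (vars-⟦⟧ φ V 1F w)
    vars-⟦⟧ (◇ φ)   V i w =
      vars-box {¬ ⟦ φ ⟧ V 0F} {¬ ⟦ φ ⟧ V 1F} (vars-⟦⟧ φ V 0F w) (vars-⟦⟧ φ V 1F w)

-- Every world is split into two copies, one for each point.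
doubleBox : Fm → Fm → Fm
doubleBox α β = □ α ∧ □ β

-- Point 0 stands for all the original worlds, point 1 for a single extra world.
pointedBox : Fm → Fm → Fm
pointedBox α β = □ α ∧ β

module D = Interpretation doubleBox
module P = Interpretation pointedBox

-- Doubling the worlds of an equivalence relation yields an equivalence relation. The claim covers
-- all `V` at once because `subs` changes the valuation.
D-sound : ∀ {φ} → ⊢ φ → ∀ V i → ⊢ D.⟦ φ ⟧ V i
D-sound (taut {φ} t) V i = taut λ v → trans (D.eval-⟦⟧ v V i φ) (t _)
D-sound K V i =
  tautology ((a ⇒ b ⇒ c) ⇒ (d ⇒ e ⇒ f) ⇒ a ∧ d ⇒ b ∧ e ⇒ c ∧ f)
    (_ ∷ _ ∷ _ ∷ _ ∷ _ ∷ _ ∷ []) · □-K · □-K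
D-sound dual V i = ↔-refl
D-sound (ax T) V 0F = tautology ((a ⇒ c) ⇒ a ∧ b ⇒ c) (_ ∷ _ ∷ _ ∷ []) · □-T
D-sound (ax T) V 1F = tautology ((b ⇒ c) ⇒ a ∧ b ⇒ c) (_ ∷ _ ∷ _ ∷ []) · □-T
D-sound (ax Four) V i =
  tautology ((a ⇒ c) ⇒ (b ⇒ d) ⇒ (c ⇒ d ⇒ e) ⇒ a ∧ b ⇒ e ∧ e)
    (_ ∷ _ ∷ _ ∷ _ ∷ _ ∷ [])
    · □-4 · □-4 · □-mono₂ (tautology (a ⇒ b ⇒ a ∧ b) (_ ∷ _ ∷ []))
D-sound (ax B) V 0F = tautology ((a ⇒ b) ⇒ a ⇒ b ∧ b) (_ ∷ _ ∷ [])
  · ⇒-trans □-B (□-mono (tautology (¬ a ⇒ ¬ (a ∧ b)) (_ ∷ _ ∷ [])))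
D-sound (ax B) V 1F = tautology ((a ⇒ b) ⇒ a ⇒ b ∧ b) (_ ∷ _ ∷ [])
  · ⇒-trans □-B (□-mono (tautology (¬ b ⇒ ¬ (a ∧ b)) (_ ∷ _ ∷ [])))
D-sound (mp x y) V i = D-sound x V i · D-sound y V i
D-sound (nec x) V i = tautology (a ⇒ b ⇒ a ∧ b) (_ ∷ _ ∷ [])
  · nec (D-sound x V 0F) · nec (D-sound x V 1F)
D-sound (subs {φ} σ x) V i = subst ⊢_ (sym (D.⟦sub⟧ σ φ V i)) (D-sound x _ i)

-- Copies that agree on all variables are indistinguishable from the world they came from.
D-diagonal : ∀ φ i → ⊢ φ ↔ D.⟦ φ ⟧ (λ _ → var) i
D-diagonal (var x) i = ↔-refl
D-diagonal ⊥ i = ↔-refl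
D-diagonal ⊤ i = ↔-refl
D-diagonal (¬ φ) i = tautology ((a ↔ˢ b) ⇒ (¬ a ↔ˢ ¬ b)) (_ ∷ _ ∷ []) · D-diagonal φ i
D-diagonal (φ ∧ ψ) i =
  tautology ((a ↔ˢ b) ⇒ (c ↔ˢ d) ⇒ (a ∧ c ↔ˢ b ∧ d)) (_ ∷ _ ∷ _ ∷ _ ∷ [])
    · D-diagonal φ i · D-diagonal ψ i
D-diagonal (φ ∨ ψ) i =
  tautology ((a ↔ˢ b) ⇒ (c ↔ˢ d) ⇒ (a ∨ c ↔ˢ b ∨ d)) (_ ∷ _ ∷ _ ∷ _ ∷ [])
    · D-diagonal φ i · D-diagonal ψ i
D-diagonal (φ ⇒ ψ) i =
  tautology ((a ↔ˢ b) ⇒ (c ↔ˢ d) ⇒ (a ⇒ c ↔ˢ b ⇒ d)) (_ ∷ _ ∷ _ ∷ _ ∷ [])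
    · D-diagonal φ i · D-diagonal ψ i
D-diagonal (□ φ) i =
  tautology ((a ↔ˢ b) ⇒ (a ↔ˢ c) ⇒ (a ↔ˢ b ∧ c)) (_ ∷ _ ∷ _ ∷ [])
    · □-equiv (D-diagonal φ 0F) · □-equiv (D-diagonal φ 1F)
D-diagonal (◇ φ) i =
  tautology ((d ↔ˢ ¬ a) ⇒ (a ↔ˢ b) ⇒ (a ↔ˢ c) ⇒ (d ↔ˢ ¬ (b ∧ c))) (_ ∷ _ ∷ _ ∷ _ ∷ [])
    · ◇-dual
    · □-equiv (tautology ((a ↔ˢ b) ⇒ (¬ a ↔ˢ ¬ b)) (_ ∷ _ ∷ []) · D-diagonal φ 0F)
    · □-equiv (tautology ((a ↔ˢ b) ⇒ (¬ a ↔ˢ ¬ b)) (_ ∷ _ ∷ []) · D-diagonal φ 1F)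

-- Boxed formulas are rigid in S5, and rigidity is closed under the connectives.
P-rigid : ∀ φ V → (∀ x → Rigid (V 1F x)) → Rigid (P.⟦ φ ⟧ V 1F)
P-rigid (var x) V r = r x
P-rigid ⊥       V r = rigid-⊥
P-rigid ⊤       V r = rigid-⊤
P-rigid (¬ φ)   V r = rigid-¬ (P-rigid φ V r)
P-rigid (φ ∧ ψ) V r = rigid-∧ (P-rigid φ V r) (P-rigid ψ V r)
P-rigid (φ ∨ ψ) V r = rigid-∨ (P-rigid φ V r) (P-rigid ψ V r)
P-rigid (φ ⇒ ψ) V r = rigid-⇒ (P-rigid φ V r) (P-rigid ψ V r)
P-rigid (□ φ)   V r = rigid-∧ rigid-□ (P-rigid φ V r)
P-rigid (◇ φ)   V r = rigid-¬ (rigid-∧ rigid-□ (rigid-¬ (P-rigid φ V r)))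

-- Simulation of one interpretation by another

-- A conditional on `ε` with the branches in the order of the points: `α` belongs to point 0, the
-- default, and `β` to point 1.
mix : Fm → Fm → Fm → Fm
mix ε α β = (ε ∧ β) ∨ (¬ ε ∧ α)

mixˢ : ∀ {n} → Schema n → Schema n → Schema n → Schema n
mixˢ s t u = (s ∧ u) ∨ (¬ s ∧ t)

-- Under η, point i of the first frame behaves like point 1 of the second where E i holds, and
-- like point 0 elsewhere.
module Simulation (box box′ : Fm → Fm → Fm) (η : Fm) (E : Fin 2 → Fm) (V V′ : Valuation) where

  open Interpretation box
  open Interpretation box′ renaming (⟦_⟧ to ⟦_⟧′) using ()

  Simulates : Fin 2 → Fm → Fm → Fm → Set
  Simulates i χ α β = ⊢ η ⇒ (χ ↔ mix (E i) α β)

  Similar : Fm → Set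
  Similar φ = ∀ i → Simulates i (⟦ φ ⟧ V i) (⟦ φ ⟧′ V′ 0F) (⟦ φ ⟧′ V′ 1F)

  Similar-box : Fm → Set
  Similar-box φ = ⊢ η ⇒
    (box (⟦ φ ⟧ V 0F) (⟦ φ ⟧ V 1F) ↔ box′ (⟦ φ ⟧′ V′ 0F) (⟦ φ ⟧′ V′ 1F))

  constantly : ∀ {χ α} i → ⊢ η ⇒ (χ ↔ α) → Simulates i χ α α
  constantly i x =
    tautology ((a ⇒ (b ↔ˢ c)) ⇒ a ⇒ (b ↔ˢ mixˢ d c c)) (_ ∷ _ ∷ _ ∷ _ ∷ []) · x

  similar-¬ : ∀ φ → Similar φ → Similar (¬ φ)
  similar-¬ φ x i = tautology
    ((a ⇒ (b ↔ˢ mixˢ c d e)) ⇒ a ⇒ (¬ b ↔ˢ mixˢ c (¬ d) (¬ e)))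
    (_ ∷ _ ∷ _ ∷ _ ∷ _ ∷ []) · x i

  module _ (similar-box : ∀ φ → Similar φ → Similar-box φ) where

    -- Connectives act pointwise and `mix` commutes with them. The box depends on the two frames, so
    -- its case is left as a hypothesis.
    similar : ∀ φ → (∀ {x} → x ∈ˡ vars φ → Similar (var x)) → Similar φ
    similar (var x) w i = w (here refl) i
    similar ⊥       w i = constantly i (⇒-const ↔-refl)
    similar ⊤       w i = constantly i (⇒-const ↔-refl)
    similar (¬ φ)   w = similar-¬ φ (similar φ w)
    similar (φ ∧ ψ) w i = tautology
      ((a ⇒ (b ↔ˢ mixˢ c d e)) ⇒ (a ⇒ (f ↔ˢ mixˢ c g h)) ⇒
        a ⇒ (b ∧ f ↔ˢ mixˢ c (d ∧ g) (e ∧ h)))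
      (_ ∷ _ ∷ _ ∷ _ ∷ _ ∷ _ ∷ _ ∷ _ ∷ [])
      · similar φ (w ∘ ∈-++⁺ˡ) i · similar ψ (w ∘ ∈-++⁺ʳ (vars φ)) i
    similar (φ ∨ ψ) w i = tautology
      ((a ⇒ (b ↔ˢ mixˢ c d e)) ⇒ (a ⇒ (f ↔ˢ mixˢ c g h)) ⇒
        a ⇒ (b ∨ f ↔ˢ mixˢ c (d ∨ g) (e ∨ h)))
      (_ ∷ _ ∷ _ ∷ _ ∷ _ ∷ _ ∷ _ ∷ _ ∷ [])
      · similar φ (w ∘ ∈-++⁺ˡ) i · similar ψ (w ∘ ∈-++⁺ʳ (vars φ)) i
    similar (φ ⇒ ψ) w i = tautology
      ((a ⇒ (b ↔ˢ mixˢ c d e)) ⇒ (a ⇒ (f ↔ˢ mixˢ c g h)) ⇒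
        a ⇒ (b ⇒ f ↔ˢ mixˢ c (d ⇒ g) (e ⇒ h)))
      (_ ∷ _ ∷ _ ∷ _ ∷ _ ∷ _ ∷ _ ∷ _ ∷ [])
      · similar φ (w ∘ ∈-++⁺ˡ) i · similar ψ (w ∘ ∈-++⁺ʳ (vars φ)) i
    similar (□ φ)   w i = constantly i (similar-box φ (similar φ w))
    -- `◇ φ` and `¬ □ ¬ φ` have the same translation by definition.
    similar (◇ φ)   w   = similar-¬ (□ ¬ φ) λ i →
      constantly i (similar-box (¬ φ) (similar-¬ φ (similar φ w)))

pick : Fm → Fm → Fin 2 → Fm
pick α β 0F = α
pick α β 1F = β

D-cong : ∀ {η} → Global η → ∀ φ V V′ →
  (∀ {x} → x ∈ˡ vars φ → ∀ i → ⊢ η ⇒ (V i x ↔ V′ i x)) → ∀ i → ⊢ η ⇒ (D.⟦ φ ⟧ V i ↔ D.⟦ φ ⟧ V′ i)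
D-cong {η} γ φ V V′ w i =
  unmix i (D.⟦ φ ⟧ V′) (S.similar similar-box φ (λ {x} m j → remix j (λ k → V′ k x) (w m j)) i)
  where
  -- False at point 0 and true at point 1, this `E` matches every point with itself. Truth is `¬ ⊥`
  -- because `Schema` has no constructor for it.
  module S = Simulation doubleBox doubleBox η (pick ⊥ (¬ ⊥)) V V′

  remix : ∀ j α {χ} → ⊢ η ⇒ (χ ↔ α j) → S.Simulates j χ (α 0F) (α 1F)
  remix 0F α x = tautology ((a ⇒ (b ↔ˢ c)) ⇒ a ⇒ (b ↔ˢ mixˢ ⊥ c d))
    (_ ∷ _ ∷ _ ∷ _ ∷ []) · x
  remix 1F α x = tautology ((a ⇒ (b ↔ˢ d)) ⇒ a ⇒ (b ↔ˢ mixˢ (¬ ⊥) c d))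
    (_ ∷ _ ∷ _ ∷ _ ∷ []) · x

  unmix : ∀ j α {χ} → S.Simulates j χ (α 0F) (α 1F) → ⊢ η ⇒ (χ ↔ α j)
  unmix 0F α x = tautology ((a ⇒ (b ↔ˢ mixˢ ⊥ c d)) ⇒ a ⇒ (b ↔ˢ c))
    (_ ∷ _ ∷ _ ∷ _ ∷ []) · x
  unmix 1F α x = tautology ((a ⇒ (b ↔ˢ mixˢ (¬ ⊥) c d)) ⇒ a ⇒ (b ↔ˢ d))
    (_ ∷ _ ∷ _ ∷ _ ∷ []) · x

  similar-box : ∀ ψ → S.Similar ψ → S.Similar-box ψ
  similar-box ψ x = tautology
    ((a ⇒ (b ↔ˢ c)) ⇒ (a ⇒ (d ↔ˢ e)) ⇒ a ⇒ (b ∧ d ↔ˢ c ∧ e)) (_ ∷ _ ∷ _ ∷ _ ∷ _ ∷ [])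
    · □-cong γ (unmix 0F (D.⟦ ψ ⟧ V′) (x 0F)) · □-cong γ (unmix 1F (D.⟦ ψ ⟧ V′) (x 1F))

-- `disjoint` leaves every world a copy where `α` decides; `inhabited` gives a copy in the cluster
-- where `β` decides, and rigidity spreads its value over the cluster.
□-mix : ∀ {η ε δ α β} → ⊢ ¬ (ε ∧ δ) → ⊢ η ⇒ ¬ □ ¬ (ε ∨ δ) → Rigid β →
  ⊢ η ⇒ (□ mix ε α β ∧ □ mix δ α β ↔ □ α ∧ β)
□-mix {η} {ε} {δ} {α} {β} disjoint inhabited r =
  tautology ((a ⇒ b ∧ c ⇒ d) ⇒ (a ⇒ b ∧ c ⇒ e) ⇒ (d ∧ e ⇒ b) ⇒ (d ∧ e ⇒ c) ⇒
      a ⇒ (b ∧ c ↔ˢ d ∧ e)) (_ ∷ _ ∷ _ ∷ _ ∷ _ ∷ [])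
    · (tautology ((a ⇒ b ⇒ c) ⇒ d ⇒ a ∧ b ⇒ c) (_ ∷ _ ∷ _ ∷ _ ∷ [])
        · □-mono₂ (tautology (¬ (a ∧ b) ⇒ mixˢ a c d ⇒ mixˢ b c d ⇒ c)
            (ε ∷ δ ∷ α ∷ β ∷ []) · disjoint))
    · (tautology ((a ⇒ b ⇒ c) ⇒ (c ⇒ d ⇒ e) ⇒ (f ⇒ ¬ e) ⇒ (g ⇒ h) ⇒ g ∨ d ⇒ f ⇒ a ∧ b ⇒ h)
          (_ ∷ _ ∷ _ ∷ _ ∷ _ ∷ _ ∷ _ ∷ _ ∷ [])
        · □-mono₂ (tautology (a ⇒ b ⇒ a ∧ b) (_ ∷ _ ∷ []))
        · □-mono₂ (tautology (mixˢ a c d ∧ mixˢ b c d ⇒ ¬ d ⇒ ¬ (a ∨ b))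
            (ε ∷ δ ∷ α ∷ β ∷ []))
        · inhabited · □-T · r)
    · □-mix-intro · □-mix-intro
  where
  □-mix-intro : ∀ {ζ} → ⊢ □ α ∧ β ⇒ □ mix ζ α β
  □-mix-intro {ζ} = tautology ((a ⇒ b ⇒ c) ⇒ (d ⇒ b) ⇒ a ∧ d ⇒ c) (_ ∷ _ ∷ _ ∷ _ ∷ [])
    · □-mono₂ (tautology (b ⇒ c ⇒ mixˢ a b c) (ζ ∷ α ∷ β ∷ []))
    · rigid⇒global r

-- Types: complete descriptions of the parameters at a world

literal : Bool → ℕ → Fm
literal true  j = var (par j)
literal false j = ¬ var (par j)

constant : Bool → Fm
constant true  = ⊤
constant false = ⊥

τ : ∀ {n} → Vec ℕ n → Vec Bool n → Fm
τ []      []       = ⊤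
τ (j ∷ r) (x ∷ xs) = literal x j ∧ τ r xs

-- An index repeated in `r` takes its first entry; conflicting entries make `τ` inconsistent.
-- Indices outside `r` default to `false`.
value : ∀ {n} → Vec ℕ n → Vec Bool n → ℕ → Bool
value []      []       j = false
value (i ∷ r) (x ∷ xs) j with j ≟ i
... | yes _ = x
... | no  _ = value r xs j

τ⇒value : ∀ {n} (r : Vec ℕ n) xs {j} → par j ∈ˡ params r →
  ⊢ τ r xs ⇒ (var (par j) ↔ constant (value r xs j))
τ⇒value (i ∷ r) (x ∷ xs) {j} m with j ≟ i | m
τ⇒value (i ∷ r) (true ∷ xs) _ | yes refl | _ =
  tautology (c ⇒ a ∧ b ⇒ (a ↔ˢ c)) (_ ∷ _ ∷ _ ∷ []) · true⊢
τ⇒value (i ∷ r) (false ∷ xs) _ | yes refl | _ =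
  tautology (¬ a ∧ b ⇒ (a ↔ˢ ⊥)) (_ ∷ _ ∷ [])
... | no j≢i | here refl = ⊥-elim (j≢i refl)
... | no j≢i | there m′  = tautology ((b ⇒ c) ⇒ a ∧ b ⇒ c) (_ ∷ _ ∷ _ ∷ []) · τ⇒value r xs m′

by-types : ∀ {n} (r : Vec ℕ n) {α} → (∀ xs → ⊢ τ r xs ⇒ α) → ⊢ α
by-types []      x = x [] · true⊢
by-types (j ∷ r) x = tautology ((a ⇒ b) ⇒ (¬ a ⇒ b) ⇒ b) (_ ∷ _ ∷ [])
  · by-types r (λ xs → tautology ((a ∧ b ⇒ c) ⇒ b ⇒ a ⇒ c) (_ ∷ _ ∷ _ ∷ []) · x (true ∷ xs))
  · by-types r (λ xs → tautology ((a ∧ b ⇒ c) ⇒ b ⇒ a ⇒ c) (_ ∷ _ ∷ _ ∷ []) · x (false ∷ xs))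

vars-τ : ∀ {n} (r : Vec ℕ n) xs → vars (τ r xs) ⊆ params r
vars-τ []      []       = λ ()
vars-τ (j ∷ r) (true  ∷ xs) (here e)  = here e
vars-τ (j ∷ r) (true  ∷ xs) (there m) = there (vars-τ r xs m)
vars-τ (j ∷ r) (false ∷ xs) (here e)  = here e
vars-τ (j ∷ r) (false ∷ xs) (there m) = there (vars-τ r xs m)

vars-constant : ∀ x {X} → vars (constant x) ⊆ X
vars-constant true  ()
vars-constant false ()

rigid-constant : ∀ x → Rigid (constant x)
rigid-constant true  = rigid-⊤
rigid-constant false = rigid-⊥

∈-params⁻ : ∀ {n} (r : Vec ℕ n) {x} → x ∈ˡ params r → ∃ λ j → x ≡ par j
∈-params⁻ (j ∷ r) (here refl) = j , refl
∈-params⁻ (j ∷ r) (there m)   = ∈-params⁻ r m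

-- Enumeration of types and finite disjunctions

-- Disjunctions in `A-S5` are indexed by `Fin k`, so types have to be numbered; `type-index` shows
-- that all are reached.
type : ∀ {n} → Fin (2 ^ n) → Vec Bool n
type i = tabulate (Inverse.to 2↔Bool ∘ finToFun i)

index : ∀ {n} → Vec Bool n → Fin (2 ^ n)
index xs = funToFin (Inverse.from 2↔Bool ∘ lookup xs)

type-index : ∀ {n} (xs : Vec Bool n) → type (index xs) ≡ xs
type-index xs = trans
  (tabulate-cong λ i → trans (cong (Inverse.to 2↔Bool) (finToFun-funToFin _ i))
                             (Inverse.strictlyInverseˡ 2↔Bool (lookup xs i)))
  (tabulate∘lookup xs)

⋁-intro : ∀ {k} (α : Fin k → Fm) i → ⊢ α i ⇒ ⋁ α
⋁-intro α zero    = tautology (a ⇒ a ∨ b) (_ ∷ _ ∷ [])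
⋁-intro α (suc i) = ⇒-trans (⋁-intro (α ∘ suc) i) (tautology (b ⇒ a ∨ b) (_ ∷ _ ∷ []))

⋁-elim : ∀ {k} (α : Fin k → Fm) {β} → (∀ i → ⊢ α i ⇒ β) → ⊢ ⋁ α ⇒ β
⋁-elim {zero}  α x = tautology (⊥ ⇒ a) (_ ∷ [])
⋁-elim {suc k} α x = tautology ((a ⇒ c) ⇒ (b ⇒ c) ⇒ a ∨ b ⇒ c) (_ ∷ _ ∷ _ ∷ [])
  · x zero · ⋁-elim (α ∘ suc) (x ∘ suc)

vars-⋁ : ∀ {k} (α : Fin k → Fm) {X} → (∀ i → vars (α i) ⊆ X) → vars (⋁ α) ⊆ X
vars-⋁ {zero}  α x = λ ()
vars-⋁ {suc k} α x = ++⊆ (x zero) (vars-⋁ (α ∘ suc) (x ∘ suc))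

-- From additivity to the normal form

assign : Fm → Fm → Valuation
assign α β i = pq≔ (pick α β i) q

-- Only the extra world satisfies p, and its type is xs. There the parameters are constants, which
-- makes truth at the extra world rigid.
pointed : ∀ {n} → Vec ℕ n → Vec Bool n → Valuation
pointed r xs i  𝕡       = pick ⊥ ⊤ i
pointed r xs i  𝕢       = ⊥
pointed r xs 0F (par j) = var (par j)
pointed r xs 1F (par j) = constant (value r xs j)

rigid-pointed : ∀ {n} (r : Vec ℕ n) xs x → Rigid (pointed r xs 1F x)
rigid-pointed r xs 𝕡       = rigid-⊤
rigid-pointed r xs 𝕢       = rigid-⊥
rigid-pointed r xs (par j) = rigid-constant (value r xs j)

module _ {n} (r : Vec ℕ n) (φ : Fm) (φ∈ : φ ∈ Fm⟨p, r ⟩) where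

  -- The φ(α, β) of the overview, evaluated at copy `i`: `α` and `β` are the extensions of `p` among
  -- the first and the second copies.
  Φ : Fm → Fm → Fin 2 → Fm
  Φ α β i = D.⟦ φ ⟧ (assign α β) i

  off on : Vec Bool n → Fm
  off xs = P.⟦ φ ⟧ (pointed r xs) 0F
  on  xs = P.⟦ φ ⟧ (pointed r xs) 1F

  Φ-cong : ∀ {η α α′ β β′} → Global η → ⊢ η ⇒ (α ↔ α′) → ⊢ η ⇒ (β ↔ β′) →
    ∀ i → ⊢ η ⇒ (Φ α β i ↔ Φ α′ β′ i)
  Φ-cong {η} {α} {α′} {β} {β′} γ x y = D-cong γ φ (assign α β) (assign α′ β′) λ {z} _ → w z
    where
    w : ∀ z i → ⊢ η ⇒ (assign α β i z ↔ assign α′ β′ i z)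
    w 𝕡       0F = x
    w 𝕡       1F = y
    w 𝕢       i  = ⇒-const ↔-refl
    w (par j) i  = ⇒-const ↔-refl

  -- Copies in `p` all have type `xs`, so they collapse into the one extra world. `disjoint` keeps
  -- every original world represented outside `p`; `inhabited` ensures that some copy represents the
  -- extra world.
  Φ-pointed : ∀ {η ε δ} xs → Global η → ⊢ ε ∨ δ ⇒ τ r xs →
    ⊢ ¬ (ε ∧ δ) → ⊢ η ⇒ ¬ □ ¬ (ε ∨ δ) →
    ∀ i → ⊢ η ⇒ (Φ ε δ i ↔ mix (pick ε δ i) (off xs) (on xs))
  Φ-pointed {η} {ε} {δ} xs γ typed disjoint inhabited = S.similar similar-box φ (w ∘ φ∈)
    where
    module S = Simulation doubleBox pointedBox η (pick ε δ) (assign ε δ) (pointed r xs)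

    typedᵢ : ∀ i → ⊢ pick ε δ i ⇒ τ r xs
    typedᵢ 0F = tautology ((a ∨ b ⇒ c) ⇒ a ⇒ c) (_ ∷ _ ∷ _ ∷ []) · typed
    typedᵢ 1F = tautology ((a ∨ b ⇒ c) ⇒ b ⇒ c) (_ ∷ _ ∷ _ ∷ []) · typed

    w : ∀ {x} → x ∈ˡ 𝕡 ∷ᴸ params r → S.Similar (var x)
    w (here refl) i = tautology (c ⇒ b ⇒ (a ↔ˢ mixˢ a ⊥ c)) (_ ∷ _ ∷ _ ∷ []) · true⊢
    w (there m)   i with _ , refl ← ∈-params⁻ r m =
      tautology ((b ⇒ c) ⇒ (c ⇒ (d ↔ˢ e)) ⇒ a ⇒ (d ↔ˢ mixˢ b d e))
        (_ ∷ _ ∷ _ ∷ _ ∷ _ ∷ []) · typedᵢ i · τ⇒value r xs m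

    similar-box : ∀ ψ → S.Similar ψ → S.Similar-box ψ
    similar-box ψ x =
      tautology ((a ⇒ (b ↔ˢ c)) ⇒ (a ⇒ (d ↔ˢ e)) ⇒ (a ⇒ (c ∧ e ↔ˢ f)) ⇒ a ⇒ (b ∧ d ↔ˢ f))
        (_ ∷ _ ∷ _ ∷ _ ∷ _ ∷ _ ∷ [])
        · □-cong γ (x 0F) · □-cong γ (x 1F)
        · □-mix disjoint inhabited (P-rigid ψ (pointed r xs) (rigid-pointed r xs))

  vars-pointed : ∀ xs i → vars (P.⟦ φ ⟧ (pointed r xs) i) ⊆ params r
  vars-pointed xs i = P.vars-⟦⟧ ++⊆ φ (pointed r xs) i (λ m j → w (φ∈ m) j)
    where
    w : ∀ {x} → x ∈ˡ 𝕡 ∷ᴸ params r → ∀ j → vars (pointed r xs j x) ⊆ params r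
    w (here refl) 0F ()
    w (here refl) 1F ()
    w (there m)   j  with ∈-params⁻ r m
    w (there m)   0F | _ , refl = λ { (here refl) → m }
    w (there m)   1F | i , refl = vars-constant (value r xs i)

  vars-Φ⊥ : ∀ i → vars (Φ ⊥ ⊥ i) ⊆ params r
  vars-Φ⊥ i = D.vars-⟦⟧ ++⊆ φ (assign ⊥ ⊥) i (λ m j → w (φ∈ m) j)
    where
    w : ∀ {x} → x ∈ˡ 𝕡 ∷ᴸ params r → ∀ j → vars (assign ⊥ ⊥ j x) ⊆ params r
    w (here refl) 0F ()
    w (here refl) 1F ()
    w (there m)   j  with _ , refl ← ∈-params⁻ r m = λ { (here refl) → m }

  Φ-cong₀ : ∀ {α α′ β β′} → ⊢ α ↔ α′ → ⊢ β ↔ β′ → ∀ i → ⊢ Φ α β i ↔ Φ α′ β′ i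
  Φ-cong₀ x y i = Φ-cong (⇒-const (nec true⊢)) (⇒-const x) (⇒-const y) i · true⊢

  Φ-pp : ⊢ φ ↔ Φ p p 0F
  Φ-pp = tautology ((a ↔ˢ b) ⇒ (b ↔ˢ c) ⇒ (a ↔ˢ c)) (_ ∷ _ ∷ _ ∷ [])
    · D-diagonal φ 0F
    · (D-cong (⇒-const (nec true⊢)) φ _ (assign p p) (λ {x} _ i → ⇒-const (w x i)) 0F · true⊢)
    where
    w : ∀ x i → ⊢ var x ↔ assign p p i x
    w 𝕡       0F = ↔-refl
    w 𝕡       1F = ↔-refl
    w 𝕢       i  = ↔-refl
    w (par j) i  = ↔-refl

  Φ-sub : ∀ ψ (α β : Fin 2 → Fm) i → let V = λ j → pq≔ (α j) (β j) in
    ⊢ D.⟦ φ ⟨ ψ ⟩ ⟧ V i ↔ Φ (D.⟦ ψ ⟧ V 0F) (D.⟦ ψ ⟧ V 1F) i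
  Φ-sub ψ α β i = subst (λ χ → ⊢ χ ↔ Φ (D.⟦ ψ ⟧ V 0F) (D.⟦ ψ ⟧ V 1F) i)
    (sym (D.⟦sub⟧ (p≔ ψ) φ V i))
    (D-cong (⇒-const (nec true⊢)) φ _ (assign _ _) (λ m j → ⇒-const (w (φ∈ m) j)) i · true⊢)
    where
    V : Valuation
    V j = pq≔ (α j) (β j)

    w : ∀ {x} → x ∈ˡ 𝕡 ∷ᴸ params r → ∀ j →
      ⊢ D.⟦ (p≔ ψ) x ⟧ V j ↔ assign (D.⟦ ψ ⟧ V 0F) (D.⟦ ψ ⟧ V 1F) j x
    w (here refl) 0F = ↔-refl
    w (here refl) 1F = ↔-refl
    w (there m)   j  with _ , refl ← ∈-params⁻ r m = ↔-refl

  module _ (additive : Additive S5 φ) where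

    -- `D-sound` applied to the derivation of additivity: the arguments become pairs of extensions,
    -- so `p` can be split between the two copies.
    Φ-∨ : ∀ α β α′ β′ i → ⊢ Φ (α ∨ α′) (β ∨ β′) i ↔ Φ α β i ∨ Φ α′ β′ i
    Φ-∨ α β α′ β′ i = tautology
      ((a ↔ˢ b ∨ c) ⇒ (a ↔ˢ d) ⇒ (b ↔ˢ e) ⇒ (c ↔ˢ f) ⇒ (d ↔ˢ e ∨ f))
      (_ ∷ _ ∷ _ ∷ _ ∷ _ ∷ _ ∷ [])
      · D-sound additive (λ j → pq≔ (pick α β j) (pick α′ β′ j)) i
      · Φ-sub (p ∨ q) (pick α β) (pick α′ β′) i
      · Φ-sub p (pick α β) (pick α′ β′) i
      · Φ-sub q (pick α β) (pick α′ β′) i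

    Φ⊥⇒Φ : ∀ α β i → ⊢ Φ ⊥ ⊥ i ⇒ Φ α β i
    Φ⊥⇒Φ α β i = tautology ((a ↔ˢ b ∨ c) ⇒ (a ↔ˢ b) ⇒ c ⇒ b) (_ ∷ _ ∷ _ ∷ [])
      · Φ-∨ α β ⊥ ⊥ i
      · Φ-cong₀ (tautology (a ∨ ⊥ ↔ˢ a) (_ ∷ [])) (tautology (a ∨ ⊥ ↔ˢ a) (_ ∷ [])) i

    -- If no world of the cluster satisfies `δ`, both sides reduce to `Φ ⊥ ⊥ 0F`. Otherwise `◇ δ` is
    -- true; putting `p` on the evaluated copies gives the conditional between `off` and `on`,
    -- putting it on the other copies gives `off`.
    Φ-type : ∀ xs → let δ = τ r xs ∧ p in
      ⊢ Φ δ δ 0F ∨ Φ ⊥ ⊥ 0F ↔ ((τ r xs ∧ on xs) ∧ p) ∨ (off xs ∧ ◇ δ) ∨ Φ ⊥ ⊥ 0F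
    Φ-type xs = tautology
      ((¬ f ⇒ (h ↔ˢ mixˢ (a ∧ b) d c ∨ d)) ⇒ (f ⇒ (h ↔ˢ e)) ⇒ (f ⇒ ¬ (a ∧ b)) ⇒ (g ↔ˢ ¬ f) ⇒
        (h ∨ e ↔ˢ ((a ∧ c) ∧ b) ∨ (d ∧ g) ∨ e))
      (τ r xs ∷ p ∷ on xs ∷ off xs ∷ Φ ⊥ ⊥ 0F ∷ □ ¬ δ ∷ ◇ δ ∷ Φ δ δ 0F ∷ [])
      · inhabited-case · empty-case · □-T · ◇-dual
      where
      δ : Fm
      δ = τ r xs ∧ p

      empty : ⊢ □ ¬ δ ⇒ (δ ↔ ⊥)
      empty = tautology ((a ⇒ ¬ b) ⇒ a ⇒ (b ↔ˢ ⊥)) (_ ∷ _ ∷ []) · □-T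

      empty-case : ⊢ □ ¬ δ ⇒ (Φ δ δ 0F ↔ Φ ⊥ ⊥ 0F)
      empty-case = Φ-cong □-4 empty empty 0F

      -- Additivity confines `p` to one copy at a time, so that every world keeps a twin outside
      -- `p`, as `Φ-pointed` requires.
      split : ⊢ Φ δ δ 0F ↔ Φ δ ⊥ 0F ∨ Φ ⊥ δ 0F
      split = tautology ((a ↔ˢ b) ⇒ (b ↔ˢ c) ⇒ (a ↔ˢ c)) (_ ∷ _ ∷ _ ∷ [])
        · Φ-cong₀ (tautology (a ↔ˢ a ∨ ⊥) (_ ∷ [])) (tautology (a ↔ˢ ⊥ ∨ a) (_ ∷ [])) 0F
        · Φ-∨ δ ⊥ ⊥ δ 0F

      inhabited-case : ⊢ ¬ □ ¬ δ ⇒ (Φ δ δ 0F ↔ mix δ (off xs) (on xs) ∨ off xs)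
      inhabited-case = tautology
        ((b ↔ˢ c ∨ d) ⇒ (a ⇒ (c ↔ˢ e)) ⇒ (a ⇒ (d ↔ˢ mixˢ ⊥ f g)) ⇒ a ⇒ (b ↔ˢ e ∨ f))
        (_ ∷ _ ∷ _ ∷ _ ∷ _ ∷ _ ∷ on xs ∷ [])
        · split
        · Φ-pointed xs □-5 (tautology ((a ∧ b) ∨ ⊥ ⇒ a) (_ ∷ _ ∷ []))
            (tautology (¬ (a ∧ ⊥)) (_ ∷ []))
            (inhabited (tautology (¬ (a ∨ ⊥) ⇒ ¬ a) (_ ∷ []))) 0F
        · Φ-pointed xs □-5 (tautology (⊥ ∨ (a ∧ b) ⇒ a) (_ ∷ _ ∷ []))
            (tautology (¬ (⊥ ∧ a)) (_ ∷ []))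
            (inhabited (tautology (¬ (⊥ ∨ a) ⇒ ¬ a) (_ ∷ []))) 0F
        where
        inhabited : ∀ {ε} → ⊢ ¬ ε ⇒ ¬ δ → ⊢ ¬ □ ¬ δ ⇒ ¬ □ ¬ ε
        inhabited x = tautology ((a ⇒ b) ⇒ ¬ b ⇒ ¬ a) (_ ∷ _ ∷ []) · □-mono x

    -- Induction by `Φ-∨`; the disjunct `Φ ⊥ ⊥ 0F` on the left is carried along and absorbed in the
    -- end by `Φ⊥⇒Φ`.
    Φ-types : ∀ {k} (t : Fin k → Vec Bool n) → let Δ = ⋁ λ i → τ r (t i) ∧ p in
      ⊢ Φ Δ Δ 0F ∨ Φ ⊥ ⊥ 0F ↔
        ((⋁ λ i → τ r (t i) ∧ on (t i)) ∧ p) ∨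
        (⋁ λ i → off (t i) ∧ ◇ (τ r (t i) ∧ p)) ∨ Φ ⊥ ⊥ 0F
    Φ-types {zero}  t = tautology (a ∨ a ↔ˢ (⊥ ∧ b) ∨ ⊥ ∨ a) (_ ∷ _ ∷ [])
    Φ-types {suc k} t = tautology
      ((a ↔ˢ b ∨ c) ⇒ (b ∨ d ↔ˢ (e ∧ f) ∨ g ∨ d) ⇒ (c ∨ d ↔ˢ (h ∧ f) ∨ at 8F ∨ d) ⇒
        (a ∨ d ↔ˢ ((e ∨ h) ∧ f) ∨ (g ∨ at 8F) ∨ d))
      (_ ∷ _ ∷ _ ∷ _ ∷ _ ∷ _ ∷ _ ∷ _ ∷ _ ∷ [])
      · Φ-∨ _ _ _ _ 0F · Φ-type (t zero) · Φ-types (t ∘ suc)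

    additive⇒A : ∃ λ ψ → ψ ∈ A-S5 r × Equivalent S5 φ ψ
    additive⇒A = _ ,
      ( 2 ^ n , Φ ⊥ ⊥ 0F , (⋁ λ i → τ r (type i) ∧ on (type i)) , off ∘ type , τ r ∘ type
      , vars-Φ⊥ 0F
      , vars-⋁ (λ i → τ r (type i) ∧ on (type i))
          (λ i → ++⊆ (vars-τ r (type i)) (vars-pointed (type i) 1F))
      , (λ i → vars-pointed (type i) 0F)
      , (λ i → vars-τ r (type i))
      , refl ) ,
      (tautology ((a ↔ˢ b) ⇒ (b ↔ˢ c) ⇒ (d ⇒ b) ⇒ (c ∨ d ↔ˢ e) ⇒ (a ↔ˢ e))
        (_ ∷ _ ∷ _ ∷ _ ∷ _ ∷ [])
        · Φ-pp · Φ-cong₀ exhaustive exhaustive 0F · Φ⊥⇒Φ p p 0F · Φ-types type)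
      where
      -- Here the finiteness of `r` enters: finitely many types cover `p`.
      exhaustive : ⊢ p ↔ ⋁ λ i → τ r (type i) ∧ p
      exhaustive = tautology (a ⇒ b ⇒ a ∧ b) (_ ∷ _ ∷ [])
        · by-types r (λ xs → tautology ((a ∧ b ⇒ c) ⇒ a ⇒ b ⇒ c) (_ ∷ _ ∷ _ ∷ [])
            · subst (λ ys → ⊢ τ r ys ∧ p ⇒ ⋁ λ i → τ r (type i) ∧ p) (type-index xs)
                (⋁-intro (λ i → τ r (type i) ∧ p) (index xs)))
        · ⋁-elim (λ i → τ r (type i) ∧ p) (λ i → tautology (a ∧ b ⇒ b) (_ ∷ _ ∷ []))

-- Formulas from A-S5 are additive

sub-id : ∀ σ φ → (∀ {x} → x ∈ˡ vars φ → σ x ≡ var x) → sub σ φ ≡ φ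
sub-id σ (var x) w = w (here refl)
sub-id σ ⊥       w = refl
sub-id σ ⊤       w = refl
sub-id σ (¬ φ)   w = cong ¬_ (sub-id σ φ w)
sub-id σ (φ ∧ ψ) w = cong₂ _∧_ (sub-id σ φ (w ∘ ∈-++⁺ˡ)) (sub-id σ ψ (w ∘ ∈-++⁺ʳ (vars φ)))
sub-id σ (φ ∨ ψ) w = cong₂ _∨_ (sub-id σ φ (w ∘ ∈-++⁺ˡ)) (sub-id σ ψ (w ∘ ∈-++⁺ʳ (vars φ)))
sub-id σ (φ ⇒ ψ) w = cong₂ _⇒_ (sub-id σ φ (w ∘ ∈-++⁺ˡ)) (sub-id σ ψ (w ∘ ∈-++⁺ʳ (vars φ)))
sub-id σ (□ φ)   w = cong □_ (sub-id σ φ w)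
sub-id σ (◇ φ)   w = cong ◇_ (sub-id σ φ w)

sub-⋁ : ∀ {k} σ (α β : Fin k → Fm) → (∀ i → sub σ (α i) ≡ β i) → sub σ (⋁ α) ≡ ⋁ β
sub-⋁ {zero}  σ α β x = refl
sub-⋁ {suc k} σ α β x = cong₂ _∨_ (x zero) (sub-⋁ σ (α ∘ suc) (β ∘ suc) (x ∘ suc))

⟨⟩-param : ∀ {n} (r : Vec ℕ n) {α} β → α ∈ Fm⟨ r ⟩ → α ⟨ β ⟩ ≡ α
⟨⟩-param r {α} β α∈ = sub-id (p≔ β) α (w ∘ α∈)
  where
  w : ∀ {x} → x ∈ˡ params r → (p≔ β) x ≡ var x
  w m with _ , refl ← ∈-params⁻ r m = refl

◇-∨ : ∀ {α β γ} → ⊢ ◇ (α ∧ (β ∨ γ)) ↔ ◇ (α ∧ β) ∨ ◇ (α ∧ γ)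
◇-∨ {α} {β} {γ} = tautology
  ((a ↔ˢ ¬ d) ⇒ (b ↔ˢ ¬ e) ⇒ (c ↔ˢ ¬ f) ⇒ (d ⇒ e) ⇒ (d ⇒ f) ⇒ (e ⇒ f ⇒ d) ⇒ (a ↔ˢ b ∨ c))
  (_ ∷ _ ∷ _ ∷ _ ∷ _ ∷ _ ∷ [])
  · ◇-dual · ◇-dual · ◇-dual
  · □-mono (tautology (¬ (a ∧ (b ∨ c)) ⇒ ¬ (a ∧ b)) (α ∷ β ∷ γ ∷ []))
  · □-mono (tautology (¬ (a ∧ (b ∨ c)) ⇒ ¬ (a ∧ c)) (α ∷ β ∷ γ ∷ []))
  · □-mono₂ (tautology (¬ (a ∧ b) ⇒ ¬ (a ∧ c) ⇒ ¬ (a ∧ (b ∨ c))) (α ∷ β ∷ γ ∷ []))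

⋁-◇-∨ : ∀ {k} (μ ν : Fin k → Fm) {α β} →
  ⊢ (⋁ λ i → μ i ∧ ◇ (ν i ∧ (α ∨ β))) ↔ (⋁ λ i → μ i ∧ ◇ (ν i ∧ α)) ∨ (⋁ λ i → μ i ∧ ◇ (ν i ∧ β))
⋁-◇-∨ {zero}  μ ν = tautology (⊥ ↔ˢ ⊥ ∨ ⊥) []
⋁-◇-∨ {suc k} μ ν = tautology
  ((b ↔ˢ c ∨ d) ⇒ (e ↔ˢ f ∨ g) ⇒ ((a ∧ b) ∨ e ↔ˢ ((a ∧ c) ∨ f) ∨ (a ∧ d) ∨ g))
  (_ ∷ _ ∷ _ ∷ _ ∷ _ ∷ _ ∷ _ ∷ []) · ◇-∨ · ⋁-◇-∨ (μ ∘ suc) (ν ∘ suc)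

-- Conjunction, `◇` and finite disjunction distribute over `∨`, and `ϰ ∨ ϰ` is equivalent to `ϰ`.
A⇒additive : ∀ {n} (r : Vec ℕ n) {ψ} → ψ ∈ A-S5 r → Additive S5 ψ
A⇒additive r (k , ϰ , ƛ , μ , ν , ϰ∈ , ƛ∈ , μ∈ , ν∈ , refl)
  = subst ⊢_
    (sym (cong₂ _↔_ (form-sub (p ∨ q)) (cong₂ _∨_ (form-sub p) (form-sub q))))
    (tautology ((d ↔ˢ e ∨ f) ⇒ ((a ∧ (b ∨ c)) ∨ d ∨ g ↔ˢ ((a ∧ b) ∨ e ∨ g) ∨ (a ∧ c) ∨ f ∨ g))
      (_ ∷ _ ∷ _ ∷ _ ∷ _ ∷ _ ∷ _ ∷ []) · ⋁-◇-∨ μ ν)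
  where
  form : Fm → Fm
  form α = (ƛ ∧ α) ∨ (⋁ λ i → μ i ∧ ◇ (ν i ∧ α)) ∨ ϰ

  form-sub : ∀ α → form p ⟨ α ⟩ ≡ form α
  form-sub α = cong₂ _∨_ (cong (_∧ α) (⟨⟩-param r α ƛ∈))
    (cong₂ _∨_
      (sub-⋁ (p≔ α) _ _ λ i →
        cong₂ (λ m n → m ∧ ◇ (n ∧ α)) (⟨⟩-param r α (μ∈ i)) (⟨⟩-param r α (ν∈ i)))
      (⟨⟩-param r α ϰ∈))

-- `subs` carries the equivalence to the instances at `p ∨ q`, `p` and `q`.
additive-cong : ∀ {φ ψ} → Equivalent S5 φ ψ → Additive S5 ψ → Additive S5 φ
additive-cong x y = tautology
  ((a ↔ˢ b) ⇒ (c ↔ˢ d) ⇒ (e ↔ˢ f) ⇒ (b ↔ˢ d ∨ f) ⇒ (a ↔ˢ c ∨ e))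
  (_ ∷ _ ∷ _ ∷ _ ∷ _ ∷ _ ∷ [])
  · subs (p≔ (p ∨ q)) x · subs (p≔ p) x · subs (p≔ q) x · y

theorem4p4 : ∀ (n : ℕ) (r : Vec ℕ n) (φ : Fm) → φ ∈ Fm⟨p, r ⟩ →
    Additive S5 φ ⇔ (∃ λ (ψ : Fm) → ψ ∈ A-S5 r × Equivalent S5 φ ψ)
theorem4p4 n r φ φ∈ = mk⇔ (additive⇒A r φ φ∈)
  λ (ψ , ψ∈ , φ↔ψ) → additive-cong φ↔ψ (A⇒additive r ψ∈)
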